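{- Let $\sqsubseteq$ be a binary relation on grammars such that: (i) $G\sqsubseteq G$ for all $G$; (ii) $G\sqsubseteq G'$ and $G'\sqsubseteq G''$ imply $G\sqsubseteq G''$; (iii) if $G'\sqsubseteq G$, then every production of $G'$ is a production of $G$; (iv) $G\setminus(n,p)\sqsubseteq G$ for every grammar $G$ and every production $(n,p)$ of $G$. Let $G,G'$ be grammars with $G'\sqsubseteq G$. Then: (1) for all terms $t$, patterns $p$ and binding sets $b$: if $G\vdash t:p_{G'}\mid b$ is derivable in the modified system, then $G\vdash t:p\mid b$ is derivable in the original system; (2) for all contexts $C$, terms $t_1,t_2$, patterns $p$ and binding sets $b$: if $G\vdash t_1=C[t_2]:p_{G'}\mid b$ is derivable in the modified system, then $G\vdash t_1=C[t_2]:p\mid b$ is derivable in the original system.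
   Context: **Terms and patterns.** Fix sets of literals $a$, pattern variables $x$ and non-terminals $n$, each with decidable equality. Terms $t,u$, list terms $l$, contexts $C$ and list contexts $L$ are mutually inductively generated by $t ::= \mathsf{lit}\,a \mid l \mid C$; $l ::= \mathsf{nil}\mid \mathsf{cons}\;t\;l$; $C ::= \mathsf{hole}\mid L$; $L ::= \mathsf{hd}\;C\;l \mid \mathsf{tl}\;t\;L$ (injections between categories are left implicit). Patterns $p$ and list patterns $q$: $p ::= \mathsf{lit}\,a\mid \mathsf{hole}\mid q\mid \mathsf{name}\,x\,p\mid \mathsf{nt}\,n\mid \mathsf{in\text{ - }hole}\,p_c\,p_h$; $q::=\mathsf{nil}\mid\mathsf{cons}\;p\;q$. A term is structured if it is $\mathsf{cons}\;t_1\;l$, with head $t_1$ and tail $l$; or $\mathsf{hd}\;C\;l$, with head $C$ and tail $l$; or $\mathsf{tl}\;t_1\;L$, with head $t_1$ and tail $L$ (heads and tails viewed as terms). Each possible tail has an underlying list term: $\lfloor l\rfloor=l$, $\lfloor \mathsf{hd}\;C\;l\rfloor=\mathsf{cons}\;C\;l$, $\lfloor\mathsf{tl}\;t\;L\rfloor=\mathsf{cons}\;t\;\lfloor L\rfloor$. The relation $u<_{\mathsf{sub}}t$ ($u$ is a proper sub-term of $t$) is the transitive closure of "$u$ is the head or the tail of the structured term $t$". Composition of contexts: $\mathsf{hole}\mathbin{+\!+}C'=C'$, $(\mathsf{hd}\;C\;l)\mathbin{+\!+}C'=\mathsf{hd}\;(C\mathbin{+\!+}C')\;l$, $(\mathsf{tl}\;t\;L)\mathbin{+\!+}C'=\mathsf{tl}\;t\;(L\mathbin{+\!+}C')$.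 **Grammars and bindings.** A production is a pair $(n,p)$. A grammar $G$ is a finite set of productions; $p\in G(n)$ means $(n,p)\in G$; $G\setminus(n,p)$ is $G$ with $(n,p)$ removed. A binding set $b$ is a finite partial function from pattern variables to terms; $\varnothing$ is the empty one. $b\sqcup b'$ is the union; it is defined only if $b$ and $b'$ agree wherever both are defined. Any rule containing $\sqcup$ applies only when the union is defined. **Modified system.** Matching $G\vdash t:p_{G'}\mid b$ and decomposition $G\vdash t=C[u]:p_{G'}\mid b$ are the least relations closed under the following rules. Matching: - $G\vdash \mathsf{lit}\,a:(\mathsf{lit}\,a)_{G'}\mid\varnothing$; $G\vdash\mathsf{hole}:\mathsf{hole}_{G'}\mid\varnothing$; $G\vdash\mathsf{nil}:\mathsf{nil}_{G'}\mid\varnothing$. - If $G\vdash t:p_{G'}\mid b$ then $G\vdash t:(\mathsf{name}\,x\,p)_{G'}\mid b\sqcup\{(x,t)\}$. - If $p\in G'(n)$ and $G\vdash t:p_{G'\setminus(n,p)}\mid b$ then $G\vdash t:(\mathsf{nt}\,n)_{G'}\mid\varnothing$. - If $s$ is structured with head $t_1$ and tail $t_2$, $G\vdash t_1:(p_1)_G\mid b_1$ and $G\vdash t_2:(p_2)_G\mid b_2$, then $G\vdash s:(\mathsf{cons}\,p_1\,p_2)_{G'}\mid b_1\sqcup b_2$. - If $G\vdash t=C[u]:(p_c)_{G'}\mid b_c$, $u<_{\mathsf{sub}}t$ and $G\vdash u:(p_h)_G\mid b_h$, then $G\vdash t:(\mathsf{in\text{ - }hole}\,p_c\,p_h)_{G'}\mid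 b_c\sqcup b_h$. - If $G\vdash t=\mathsf{hole}[t]:(p_c)_{G'}\mid b_c$ and $G\vdash t:(p_h)_{G'}\mid b_h$, then $G\vdash t:(\mathsf{in\text{ - }hole}\,p_c\,p_h)_{G'}\mid b_c\sqcup b_h$. Decomposition: - $G\vdash t=\mathsf{hole}[t]:\mathsf{hole}_{G'}\mid\varnothing$. - If $s$ is structured with head $t_1$ and tail $t_2$, $G\vdash t_1=C[u]:(p_1)_G\mid b_1$ and $G\vdash t_2:(p_2)_G\mid b_2$, then $G\vdash s=(\mathsf{hd}\;C\;\lfloor t_2\rfloor)[u]:(\mathsf{cons}\,p_1\,p_2)_{G'}\mid b_1\sqcup b_2$. - If $s$ is structured with head $t_1$ and tail $t_2$, $G\vdash t_1:(p_1)_G\mid b_1$ and $G\vdash t_2=C[u]:(p_2)_G\mid b_2$ with $C$ a list context, then $G\vdash s=(\mathsf{tl}\;t_1\;C)[u]:(\mathsf{cons}\,p_1\,p_2)_{G'}\mid b_1\sqcup b_2$. - If $p\in G'(n)$ and $G\vdash t=C[u]:p_{G'\setminus(n,p)}\mid b$ then $G\vdash t=C[u]:(\mathsf{nt}\,n)_{G'}\mid\varnothing$. - If $G\vdash t=C_c[t_c]:(p_c)_{G'}\mid b_c$, $t_c<_{\mathsf{sub}}t$ and $G\vdash t_c=C_h[t_h]:(p_h)_G\mid b_h$, then $G\vdash t=(C_c\mathbin{+\!+}C_h)[t_h]:(\mathsf{in\text{ - }hole}\,p_c\,p_h)_{G'}\mid b_c\sqcup b_h$. - If $G\vdash t=\mathsf{hole}[t]:(p_c)_{G'}\mid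 b_c$ and $G\vdash t=C_h[t_h]:(p_h)_{G'}\mid b_h$, then $G\vdash t=(\mathsf{hole}\mathbin{+\!+}C_h)[t_h]:(\mathsf{in\text{ - }hole}\,p_c\,p_h)_{G'}\mid b_c\sqcup b_h$. - If $G\vdash t=C[u]:p_{G'}\mid b$ then $G\vdash t=C[u]:(\mathsf{name}\,x\,p)_{G'}\mid b\sqcup\{(x,C)\}$. **Original system** (single grammar $G$). Matching $G\vdash t:p\mid b$ and decomposition $G\vdash t=C[u]:p\mid b$ are the least relations closed under the following rules. Matching: - $G\vdash \mathsf{lit}\,a:\mathsf{lit}\,a\mid\varnothing$; $G\vdash\mathsf{hole}:\mathsf{hole}\mid\varnothing$; $G\vdash\mathsf{nil}:\mathsf{nil}\mid\varnothing$. - If $G\vdash t:p\mid b$ then $G\vdash t:\mathsf{name}\,x\,p\mid b\sqcup\{(x,t)\}$. - If $p\in G(n)$ and $G\vdash t:p\mid b$ then $G\vdash t:\mathsf{nt}\,n\mid\varnothing$. - If $s$ is structured with head $t_1$ and tail $t_2$, $G\vdash t_1:p_1\mid b_1$ and $G\vdash t_2:p_2\mid b_2$, then $G\vdash s:\mathsf{cons}\,p_1\,p_2\mid b_1\sqcup b_2$. - If $G\vdash t=C[u]:p_c\mid b_c$ and $G\vdash u:p_h\mid b_h$, then $G\vdash t:\mathsf{in\text{ - }hole}\,p_c\,p_h\mid b_c\sqcup b_h$. Decomposition: - $G\vdash t=\mathsf{hole}[t]:\mathsf{hole}\mid\varnothing$. - If $s$ is structured with head $t_1$ and tail $t_2$,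 $G\vdash t_1=C[u]:p_1\mid b_1$ and $G\vdash t_2:p_2\mid b_2$, then $G\vdash s=(\mathsf{hd}\;C\;\lfloor t_2\rfloor)[u]:\mathsf{cons}\,p_1\,p_2\mid b_1\sqcup b_2$. - If $s$ is structured with head $t_1$ and tail $t_2$, $G\vdash t_1:p_1\mid b_1$ and $G\vdash t_2=C[u]:p_2\mid b_2$ with $C$ a list context, then $G\vdash s=(\mathsf{tl}\;t_1\;C)[u]:\mathsf{cons}\,p_1\,p_2\mid b_1\sqcup b_2$. - If $p\in G(n)$ and $G\vdash t=C[u]:p\mid b$ then $G\vdash t=C[u]:\mathsf{nt}\,n\mid\varnothing$. - If $G\vdash t=C_c[t_c]:p_c\mid b_c$ and $G\vdash t_c=C_h[t_h]:p_h\mid b_h$, then $G\vdash t=(C_c\mathbin{+\!+}C_h)[t_h]:\mathsf{in\text{ - }hole}\,p_c\,p_h\mid b_c\sqcup b_h$. - If $G\vdash t=C[u]:p\mid b$ then $G\vdash t=C[u]:\mathsf{name}\,x\,p\mid b\sqcup\{(x,C)\}$. -}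

module Defs where

open import Data.List.Base using (List; []; _∷_; filter; map)
open import Data.List.Membership.Propositional using (_∈_)
open import Data.List.Membership.Propositional.Properties using (∈-map⁺; ∈-map⁻)
open import Data.List.Relation.Unary.All as All using ([])
open import Data.List.Relation.Unary.All.Properties using (¬Any⇒All¬)
open import Data.List.Relation.Unary.AllPairs using ([]; _∷_)
open import Data.List.Relation.Unary.Any using (here; there; any?)
open import Data.List.Relation.Unary.Unique.Propositional using (Unique)
open import Data.Product using (_×_; _,_; proj₁; ∃)
open import Data.Product.Properties using (≡-dec)
open import Data.Sum using (_⊎_; inj₁; inj₂; map₁)
open import Function.Base using (_∘_)
open import Function.Bundles using (_⇔_; mk⇔; Equivalence)
open import Level using (0ℓ)
open import Relation.Binary.Construct.Closure.Transitive using (TransClosure)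
open import Relation.Binary.Core using (Rel)
open import Relation.Binary.Definitions using (DecidableEquality)
open import Relation.Binary.PropositionalEquality using (_≡_; refl; sym; cong; subst)
open import Relation.Nullary using (yes; no; contradiction; ¬?)
open import Relation.Nullary.Decidable using (map′; _×-dec_)

module Redex
  {Lit Var NonTerm : Set}
  (_≟ˡ_ : DecidableEquality Lit)
  (_≟ˣ_ : DecidableEquality Var)
  (_≟ⁿ_ : DecidableEquality NonTerm)
  where

  infixr 5 _++_ _++ᴸ_
  infix 6 _∖_
  infix 4 _≟ᵖ_ _≟ᵠ_ _◁_ _<sub_ _[_]≔_ _≈_⊔_

  data Term : Set
  data ListTerm : Set
  data Context : Set
  data ListContext : Set

  data Term where
    lit  : Lit → Term
    list : ListTerm → Term
    ctx  : Context → Term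

  data ListTerm where
    nil  : ListTerm
    cons : Term → ListTerm → ListTerm

  data Context where
    hole : Context
    lctx : ListContext → Context

  data ListContext where
    hd : Context → ListTerm → ListContext
    tl : Term → ListContext → ListContext

  data Pattern : Set
  data ListPattern : Set

  data Pattern where
    lit     : Lit → Pattern
    hole    : Pattern
    list    : ListPattern → Pattern
    name    : Var → Pattern → Pattern
    nt      : NonTerm → Pattern
    in-hole : Pattern → Pattern → Pattern

  data ListPattern where
    nil  : ListPattern
    cons : Pattern → ListPattern → ListPattern

  -- The tail of a structured term is a list term or a list context.
  data Tail : Set where
    list : ListTerm → Tail
    lctx : ListContext → Tail

  tailTerm : Tail → Term
  tailTerm (list l) = list l
  tailTerm (lctx L) = ctx (lctx L)

  ⌊_⌋ᴸ : ListContext → ListTerm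
  ⌊ hd C l ⌋ᴸ = cons (ctx C) l
  ⌊ tl t L ⌋ᴸ = cons t ⌊ L ⌋ᴸ

  ⌊_⌋ : Tail → ListTerm
  ⌊ list l ⌋ = l
  ⌊ lctx L ⌋ = ⌊ L ⌋ᴸ

  -- Structured s t₁ t₂: s is structured with head t₁ and tail t₂.
  data Structured : Term → Term → Tail → Set where
    cons : ∀ {t l} → Structured (list (cons t l)) t (list l)
    hd   : ∀ {C l} → Structured (ctx (lctx (hd C l))) (ctx C) (list l)
    tl   : ∀ {t L} → Structured (ctx (lctx (tl t L))) t (lctx L)

  data _◁_ : Rel Term 0ℓ where
    head : ∀ {s t₁ t₂} → Structured s t₁ t₂ → t₁ ◁ s
    tail : ∀ {s t₁ t₂} → Structured s t₁ t₂ → tailTerm t₂ ◁ s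

  _<sub_ : Rel Term 0ℓ
  _<sub_ = TransClosure _◁_

  _++_  : Context → Context → Context
  _++ᴸ_ : ListContext → Context → ListContext

  hole   ++ C′ = C′
  lctx L ++ C′ = lctx (L ++ᴸ C′)

  hd C l ++ᴸ C′ = hd (C ++ C′) l
  tl t L ++ᴸ C′ = tl t (L ++ᴸ C′)

  _≟ᵖ_ : DecidableEquality Pattern
  _≟ᵠ_ : DecidableEquality ListPattern

  (lit a)       ≟ᵖ (lit a′)      = map′ (cong lit) (λ { refl → refl }) (a ≟ˡ a′)
  (lit _)       ≟ᵖ hole          = no λ ()
  (lit _)       ≟ᵖ (list _)      = no λ ()
  (lit _)       ≟ᵖ (name _ _)    = no λ ()
  (lit _)       ≟ᵖ (nt _)        = no λ ()
  (lit _)       ≟ᵖ (in-hole _ _) = no λ ()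
  hole          ≟ᵖ (lit _)       = no λ ()
  hole          ≟ᵖ hole          = yes refl
  hole          ≟ᵖ (list _)      = no λ ()
  hole          ≟ᵖ (name _ _)    = no λ ()
  hole          ≟ᵖ (nt _)        = no λ ()
  hole          ≟ᵖ (in-hole _ _) = no λ ()
  (list _)      ≟ᵖ (lit _)       = no λ ()
  (list _)      ≟ᵖ hole          = no λ ()
  (list q)      ≟ᵖ (list q′)     = map′ (cong list) (λ { refl → refl }) (q ≟ᵠ q′)
  (list _)      ≟ᵖ (name _ _)    = no λ ()
  (list _)      ≟ᵖ (nt _)        = no λ ()
  (list _)      ≟ᵖ (in-hole _ _) = no λ ()
  (name _ _)    ≟ᵖ (lit _)       = no λ ()
  (name _ _)    ≟ᵖ hole          = no λ ()
  (name _ _)    ≟ᵖ (list _)      = no λ ()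
  (name x p)    ≟ᵖ (name x′ p′)  =
    map′ (λ { (refl , refl) → refl }) (λ { refl → refl , refl }) (x ≟ˣ x′ ×-dec p ≟ᵖ p′)
  (name _ _)    ≟ᵖ (nt _)        = no λ ()
  (name _ _)    ≟ᵖ (in-hole _ _) = no λ ()
  (nt _)        ≟ᵖ (lit _)       = no λ ()
  (nt _)        ≟ᵖ hole          = no λ ()
  (nt _)        ≟ᵖ (list _)      = no λ ()
  (nt _)        ≟ᵖ (name _ _)    = no λ ()
  (nt n)        ≟ᵖ (nt n′)       = map′ (cong nt) (λ { refl → refl }) (n ≟ⁿ n′)
  (nt _)        ≟ᵖ (in-hole _ _) = no λ ()
  (in-hole _ _) ≟ᵖ (lit _)       = no λ ()
  (in-hole _ _) ≟ᵖ hole          = no λ ()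
  (in-hole _ _) ≟ᵖ (list _)      = no λ ()
  (in-hole _ _) ≟ᵖ (name _ _)    = no λ ()
  (in-hole _ _) ≟ᵖ (nt _)        = no λ ()
  (in-hole pc ph) ≟ᵖ (in-hole pc′ ph′) =
    map′ (λ { (refl , refl) → refl }) (λ { refl → refl , refl }) (pc ≟ᵖ pc′ ×-dec ph ≟ᵖ ph′)

  nil        ≟ᵠ nil          = yes refl
  nil        ≟ᵠ (cons _ _)   = no λ ()
  (cons _ _) ≟ᵠ nil          = no λ ()
  (cons p q) ≟ᵠ (cons p′ q′) =
    map′ (λ { (refl , refl) → refl }) (λ { refl → refl , refl }) (p ≟ᵖ p′ ×-dec q ≟ᵠ q′)

  Production : Set
  Production = NonTerm × Pattern

  -- Any list with the same members represents a given finite set: a grammar is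
  -- used only through membership and _∖_, which respect equality of members.
  Grammar : Set
  Grammar = List Production

  -- All occurrences are removed, so that (n , p) is not a member of G ∖ (n , p).
  _∖_ : Grammar → Production → Grammar
  G ∖ r = filter (λ r′ → ¬? (≡-dec _≟ⁿ_ _≟ᵖ_ r′ r)) G

  record Bindings : Set where
    constructor bindings
    field
      entries : List (Var × Term)
      unique  : Unique (map proj₁ entries)

  open Bindings

  _[_]≔_ : Bindings → Var → Term → Set
  b [ x ]≔ t = (x , t) ∈ entries b

  ∅ : Bindings
  ∅ = bindings [] []

  ⁅_↦_⁆ : Var → Term → Bindings
  ⁅ x ↦ t ⁆ = bindings ((x , t) ∷ []) ([] ∷ [])

  -- "b₁ ⊔ b₂ is defined and equal to b" as finite partial functions. Such a b
  -- exists exactly when b₁ and b₂ agree (⊔⇒agree and agree⇒⊔ below); it is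
  -- determined up to the order of its entries.
  _≈_⊔_ : Bindings → Bindings → Bindings → Set
  b ≈ b₁ ⊔ b₂ = ∀ x t → b [ x ]≔ t ⇔ (b₁ [ x ]≔ t ⊎ b₂ [ x ]≔ t)

  Agree : Bindings → Bindings → Set
  Agree b₁ b₂ = ∀ {x t u} → b₁ [ x ]≔ t → b₂ [ x ]≔ u → t ≡ u

  functional : ∀ b {x t u} → b [ x ]≔ t → b [ x ]≔ u → t ≡ u
  functional (bindings _ _)        (here refl) (here refl) = refl
  functional (bindings _ (x∉ ∷ _)) (here refl) (there m)   =
    contradiction refl (All.lookup x∉ (∈-map⁺ proj₁ m))
  functional (bindings _ (x∉ ∷ _)) (there m)   (here refl) =
    contradiction refl (All.lookup x∉ (∈-map⁺ proj₁ m))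
  functional (bindings _ (_ ∷ !b)) (there m)   (there m′)  =
    functional (bindings _ !b) m m′

  ⊔⇒agree : ∀ {b b₁ b₂} → b ≈ b₁ ⊔ b₂ → Agree b₁ b₂
  ⊔⇒agree {b} eq m₁ m₂ =
    functional b (Equivalence.from (eq _ _) (inj₁ m₁)) (Equivalence.from (eq _ _) (inj₂ m₂))

  agree⇒⊔ : ∀ b₁ b₂ → Agree b₁ b₂ → ∃ λ b → b ≈ b₁ ⊔ b₂
  agree⇒⊔ (bindings [] _) b₂ _ = b₂ , λ _ _ → mk⇔ inj₂ λ { (inj₁ ()) ; (inj₂ m) → m }
  agree⇒⊔ (bindings ((x , t) ∷ es) (x∉es ∷ !es)) b₂ agree
    with agree⇒⊔ (bindings es !es) b₂ (agree ∘ there)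
  ... | b , eq with any? (x ≟ˣ_) (map proj₁ (entries b))
  ...   | no x∉b = bindings ((x , t) ∷ entries b) (¬Any⇒All¬ _ x∉b ∷ unique b) , λ y u → mk⇔
    (λ { (here refl) → inj₁ (here refl)
       ; (there m)   → map₁ there (Equivalence.to (eq y u) m) })
    (λ { (inj₁ (here refl)) → here refl
       ; (inj₁ (there m))   → there (Equivalence.from (eq y u) (inj₁ m))
       ; (inj₂ m)           → there (Equivalence.from (eq y u) (inj₂ m)) })
  ...   | yes x∈b with ∈-map⁻ proj₁ x∈b
  ...     | (.x , v) , xv∈b , refl = b , λ y u → mk⇔
    (λ m → map₁ there (Equivalence.to (eq y u) m))
    (λ { (inj₁ (here refl)) → subst (b [ x ]≔_) (sym (t≡v (Equivalence.to (eq x v) xv∈b))) xv∈b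
       ; (inj₁ (there m))   → Equivalence.from (eq y u) (inj₁ m)
       ; (inj₂ m)           → Equivalence.from (eq y u) (inj₂ m) })
    where
    t≡v : (x , v) ∈ es ⊎ b₂ [ x ]≔ v → t ≡ v
    t≡v (inj₁ m) = contradiction refl (All.lookup x∉es (∈-map⁺ proj₁ m))
    t≡v (inj₂ m) = agree (here refl) m

  module Modified (G : Grammar) where

    infix 3 ⊢_∶_∥_∣_ ⊢_≐_⟦_⟧∶_∥_∣_

    -- ⊢ t ∶ p ∥ G′ ∣ b            is  G ⊢ t : p_{G′} | b,
    -- ⊢ t ≐ C ⟦ u ⟧∶ p ∥ G′ ∣ b  is  G ⊢ t = C[u] : p_{G′} | b.
    data ⊢_∶_∥_∣_ : Term → Pattern → Grammar → Bindings → Set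

    data ⊢_≐_⟦_⟧∶_∥_∣_ : Term → Context → Term → Pattern → Grammar → Bindings → Set

    data ⊢_∶_∥_∣_ where

      m-lit : ∀ {a G′} → ⊢ lit a ∶ lit a ∥ G′ ∣ ∅

      m-hole : ∀ {G′} → ⊢ ctx hole ∶ hole ∥ G′ ∣ ∅

      m-nil : ∀ {G′} → ⊢ list nil ∶ list nil ∥ G′ ∣ ∅

      m-name : ∀ {t x p G′ b b′} →
        ⊢ t ∶ p ∥ G′ ∣ b →
        b′ ≈ b ⊔ ⁅ x ↦ t ⁆ →
        ⊢ t ∶ name x p ∥ G′ ∣ b′

      m-nt : ∀ {t n p G′ b} →
        (n , p) ∈ G′ →
        ⊢ t ∶ p ∥ G′ ∖ (n , p) ∣ b →
        ⊢ t ∶ nt n ∥ G′ ∣ ∅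

      m-cons : ∀ {s t₁ t₂ p₁ p₂ G′ b₁ b₂ b} →
        Structured s t₁ t₂ →
        ⊢ t₁ ∶ p₁ ∥ G ∣ b₁ →
        ⊢ tailTerm t₂ ∶ list p₂ ∥ G ∣ b₂ →
        b ≈ b₁ ⊔ b₂ →
        ⊢ s ∶ list (cons p₁ p₂) ∥ G′ ∣ b

      m-in-hole-sub : ∀ {t C u pc ph G′ bc bh b} →
        ⊢ t ≐ C ⟦ u ⟧∶ pc ∥ G′ ∣ bc →
        u <sub t →
        ⊢ u ∶ ph ∥ G ∣ bh →
        b ≈ bc ⊔ bh →
        ⊢ t ∶ in-hole pc ph ∥ G′ ∣ b

      m-in-hole-hole : ∀ {t pc ph G′ bc bh b} →
        ⊢ t ≐ hole ⟦ t ⟧∶ pc ∥ G′ ∣ bc →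
        ⊢ t ∶ ph ∥ G′ ∣ bh →
        b ≈ bc ⊔ bh →
        ⊢ t ∶ in-hole pc ph ∥ G′ ∣ b

    data ⊢_≐_⟦_⟧∶_∥_∣_ where

      d-hole : ∀ {t G′} → ⊢ t ≐ hole ⟦ t ⟧∶ hole ∥ G′ ∣ ∅

      d-hd : ∀ {s t₁ t₂ C u p₁ p₂ G′ b₁ b₂ b} →
        Structured s t₁ t₂ →
        ⊢ t₁ ≐ C ⟦ u ⟧∶ p₁ ∥ G ∣ b₁ →
        ⊢ tailTerm t₂ ∶ list p₂ ∥ G ∣ b₂ →
        b ≈ b₁ ⊔ b₂ →
        ⊢ s ≐ lctx (hd C ⌊ t₂ ⌋) ⟦ u ⟧∶ list (cons p₁ p₂) ∥ G′ ∣ b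

      d-tl : ∀ {s t₁ t₂ L u p₁ p₂ G′ b₁ b₂ b} →
        Structured s t₁ t₂ →
        ⊢ t₁ ∶ p₁ ∥ G ∣ b₁ →
        ⊢ tailTerm t₂ ≐ lctx L ⟦ u ⟧∶ list p₂ ∥ G ∣ b₂ →
        b ≈ b₁ ⊔ b₂ →
        ⊢ s ≐ lctx (tl t₁ L) ⟦ u ⟧∶ list (cons p₁ p₂) ∥ G′ ∣ b

      d-nt : ∀ {t C u n p G′ b} →
        (n , p) ∈ G′ →
        ⊢ t ≐ C ⟦ u ⟧∶ p ∥ G′ ∖ (n , p) ∣ b →
        ⊢ t ≐ C ⟦ u ⟧∶ nt n ∥ G′ ∣ ∅

      d-in-hole-sub : ∀ {t Cc tc Ch th pc ph G′ bc bh b} →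
        ⊢ t ≐ Cc ⟦ tc ⟧∶ pc ∥ G′ ∣ bc →
        tc <sub t →
        ⊢ tc ≐ Ch ⟦ th ⟧∶ ph ∥ G ∣ bh →
        b ≈ bc ⊔ bh →
        ⊢ t ≐ Cc ++ Ch ⟦ th ⟧∶ in-hole pc ph ∥ G′ ∣ b

      d-in-hole-hole : ∀ {t Ch th pc ph G′ bc bh b} →
        ⊢ t ≐ hole ⟦ t ⟧∶ pc ∥ G′ ∣ bc →
        ⊢ t ≐ Ch ⟦ th ⟧∶ ph ∥ G′ ∣ bh →
        b ≈ bc ⊔ bh →
        ⊢ t ≐ hole ++ Ch ⟦ th ⟧∶ in-hole pc ph ∥ G′ ∣ b

      d-name : ∀ {t C u x p G′ b b′} →
        ⊢ t ≐ C ⟦ u ⟧∶ p ∥ G′ ∣ b →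
        b′ ≈ b ⊔ ⁅ x ↦ ctx C ⁆ →
        ⊢ t ≐ C ⟦ u ⟧∶ name x p ∥ G′ ∣ b′

  module Original (G : Grammar) where

    infix 3 ⊢_∶_∣_ ⊢_≐_⟦_⟧∶_∣_

    data ⊢_∶_∣_ : Term → Pattern → Bindings → Set

    data ⊢_≐_⟦_⟧∶_∣_ : Term → Context → Term → Pattern → Bindings → Set

    data ⊢_∶_∣_ where

      m-lit : ∀ {a} → ⊢ lit a ∶ lit a ∣ ∅

      m-hole : ⊢ ctx hole ∶ hole ∣ ∅

      m-nil : ⊢ list nil ∶ list nil ∣ ∅

      m-name : ∀ {t x p b b′} →
        ⊢ t ∶ p ∣ b →
        b′ ≈ b ⊔ ⁅ x ↦ t ⁆ →
        ⊢ t ∶ name x p ∣ b′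

      m-nt : ∀ {t n p b} →
        (n , p) ∈ G →
        ⊢ t ∶ p ∣ b →
        ⊢ t ∶ nt n ∣ ∅

      m-cons : ∀ {s t₁ t₂ p₁ p₂ b₁ b₂ b} →
        Structured s t₁ t₂ →
        ⊢ t₁ ∶ p₁ ∣ b₁ →
        ⊢ tailTerm t₂ ∶ list p₂ ∣ b₂ →
        b ≈ b₁ ⊔ b₂ →
        ⊢ s ∶ list (cons p₁ p₂) ∣ b

      m-in-hole : ∀ {t C u pc ph bc bh b} →
        ⊢ t ≐ C ⟦ u ⟧∶ pc ∣ bc →
        ⊢ u ∶ ph ∣ bh →
        b ≈ bc ⊔ bh →
        ⊢ t ∶ in-hole pc ph ∣ b

    data ⊢_≐_⟦_⟧∶_∣_ where

      d-hole : ∀ {t} → ⊢ t ≐ hole ⟦ t ⟧∶ hole ∣ ∅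

      d-hd : ∀ {s t₁ t₂ C u p₁ p₂ b₁ b₂ b} →
        Structured s t₁ t₂ →
        ⊢ t₁ ≐ C ⟦ u ⟧∶ p₁ ∣ b₁ →
        ⊢ tailTerm t₂ ∶ list p₂ ∣ b₂ →
        b ≈ b₁ ⊔ b₂ →
        ⊢ s ≐ lctx (hd C ⌊ t₂ ⌋) ⟦ u ⟧∶ list (cons p₁ p₂) ∣ b

      d-tl : ∀ {s t₁ t₂ L u p₁ p₂ b₁ b₂ b} →
        Structured s t₁ t₂ →
        ⊢ t₁ ∶ p₁ ∣ b₁ →
        ⊢ tailTerm t₂ ≐ lctx L ⟦ u ⟧∶ list p₂ ∣ b₂ →
        b ≈ b₁ ⊔ b₂ →
        ⊢ s ≐ lctx (tl t₁ L) ⟦ u ⟧∶ list (cons p₁ p₂) ∣ b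

      d-nt : ∀ {t C u n p b} →
        (n , p) ∈ G →
        ⊢ t ≐ C ⟦ u ⟧∶ p ∣ b →
        ⊢ t ≐ C ⟦ u ⟧∶ nt n ∣ ∅

      d-in-hole : ∀ {t Cc tc Ch th pc ph bc bh b} →
        ⊢ t ≐ Cc ⟦ tc ⟧∶ pc ∣ bc →
        ⊢ tc ≐ Ch ⟦ th ⟧∶ ph ∣ bh →
        b ≈ bc ⊔ bh →
        ⊢ t ≐ Cc ++ Ch ⟦ th ⟧∶ in-hole pc ph ∣ b

      d-name : ∀ {t C u x p b b′} →
        ⊢ t ≐ C ⟦ u ⟧∶ p ∣ b →
        b′ ≈ b ⊔ ⁅ x ↦ ctx C ⁆ →
        ⊢ t ≐ C ⟦ u ⟧∶ name x p ∣ b′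

  open Modified public renaming
    ( ⊢_∶_∥_∣_       to infix 3 _⊢_∶_∥_∣_
    ; ⊢_≐_⟦_⟧∶_∥_∣_ to infix 3 _⊢_≐_⟦_⟧∶_∥_∣_ )
    using ()
  open Original public renaming
    ( ⊢_∶_∣_       to infix 3 _⊢_∶_∣_
    ; ⊢_≐_⟦_⟧∶_∣_ to infix 3 _⊢_≐_⟦_⟧∶_∣_ )
    using ()

{-# OPTIONS --safe #-}

-- Only inclusion G′ ⊆ G is needed of G′ ⊑ G. It persists along derivations, since every
-- rule of the modified system continues with G′, with G′ ∖ (n , p) or with G itself; so
-- erasing the second grammar from a derivation gives one in the original system, the two
-- in-hole rules of each kind collapsing to one.

module Submission where

open import Defs
open import Data.List.Membership.Propositional using (_∈_)
open import Data.List.Relation.Binary.Subset.Propositional using (_⊆_)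
open import Data.List.Relation.Binary.Subset.Propositional.Properties
  using (⊆-refl; ⊆-trans; filter-⊆)
open import Data.Product using (_×_; _,_)
open import Relation.Binary.Core using (Rel)
open import Relation.Binary.Definitions using (DecidableEquality; Reflexive; Transitive)

module Erasure
  {Lit Var NonTerm : Set}
  (_≟ˡ_ : DecidableEquality Lit)
  (_≟ˣ_ : DecidableEquality Var)
  (_≟ⁿ_ : DecidableEquality NonTerm)
  where

  open Redex _≟ˡ_ _≟ˣ_ _≟ⁿ_
  open Modified using
    ( m-lit; m-hole; m-nil; m-name; m-nt; m-cons; m-in-hole-sub; m-in-hole-hole
    ; d-hole; d-hd; d-tl; d-nt; d-in-hole-sub; d-in-hole-hole; d-name )
  module O = Original

  ∖-⊆ : ∀ G r → (G ∖ r) ⊆ G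
  ∖-⊆ G r = filter-⊆ _ G

  -- `G′` stays general because recursive calls replace it by `G′ ∖ (n , p)` or by `G`. The
  -- recursion is mutual: in-hole matching decomposes, and cons decomposition matches.
  erase-match : ∀ {G G′ t p b} → G′ ⊆ G →
    G ⊢ t ∶ p ∥ G′ ∣ b → G ⊢ t ∶ p ∣ b

  erase-decomp : ∀ {G G′ t C u p b} → G′ ⊆ G →
    G ⊢ t ≐ C ⟦ u ⟧∶ p ∥ G′ ∣ b → G ⊢ t ≐ C ⟦ u ⟧∶ p ∣ b

  erase-match G′⊆G m-lit                    = O.m-lit
  erase-match G′⊆G m-hole                   = O.m-hole
  erase-match G′⊆G m-nil                    = O.m-nil
  -- Here and below `b` is the proof of the union; erasure keeps all bindings, so it carries over as
  -- it is.
  erase-match G′⊆G (m-name m b)             = O.m-name (erase-match G′⊆G m) b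
  erase-match G′⊆G (m-nt p∈G′ m)            =
    O.m-nt (G′⊆G p∈G′) (erase-match (⊆-trans (∖-⊆ _ _) G′⊆G) m)
  -- Head and tail are matched with the full `G`, so the inclusion restarts at `⊆-refl`.
  erase-match G′⊆G (m-cons s m₁ m₂ b)       =
    O.m-cons s (erase-match ⊆-refl m₁) (erase-match ⊆-refl m₂) b
  erase-match G′⊆G (m-in-hole-sub d _ m b)  =
    O.m-in-hole (erase-decomp G′⊆G d) (erase-match ⊆-refl m) b
  -- The original rule at `C = hole`, `u = t`; both premises carry `G′`.
  erase-match G′⊆G (m-in-hole-hole d m b)   =
    O.m-in-hole (erase-decomp G′⊆G d) (erase-match G′⊆G m) b

  erase-decomp G′⊆G d-hole                  = O.d-hole
  erase-decomp G′⊆G (d-hd s d m b)          =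
    O.d-hd s (erase-decomp ⊆-refl d) (erase-match ⊆-refl m) b
  erase-decomp G′⊆G (d-tl s m d b)          =
    O.d-tl s (erase-match ⊆-refl m) (erase-decomp ⊆-refl d) b
  erase-decomp G′⊆G (d-nt p∈G′ d)           =
    O.d-nt (G′⊆G p∈G′) (erase-decomp (⊆-trans (∖-⊆ _ _) G′⊆G) d)
  erase-decomp G′⊆G (d-in-hole-sub d _ e b) =
    O.d-in-hole (erase-decomp G′⊆G d) (erase-decomp ⊆-refl e) b
  -- With `Cc = hole` and `tc = t`, the context `hole ++ Ch` already has the form `Cc ++ Ch`.
  erase-decomp G′⊆G (d-in-hole-hole d e b)  =
    O.d-in-hole (erase-decomp G′⊆G d) (erase-decomp G′⊆G e) b
  erase-decomp G′⊆G (d-name d b)            = O.d-name (erase-decomp G′⊆G d) b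

theorem4 : ∀ {Lit Var NonTerm : Set}
    (_≟ˡ_ : DecidableEquality Lit)
    (_≟ˣ_ : DecidableEquality Var)
    (_≟ⁿ_ : DecidableEquality NonTerm) →
    let open Redex _≟ˡ_ _≟ˣ_ _≟ⁿ_ in
    ∀ {ℓ} (_⊑_ : Rel Grammar ℓ) →
    Reflexive _⊑_ →
    Transitive _⊑_ →
    (∀ {G G′} → G′ ⊑ G → G′ ⊆ G) →
    (∀ {G n p} → (n , p) ∈ G → (G ∖ (n , p)) ⊑ G) →
    ∀ {G G′} → G′ ⊑ G →
    (∀ t p b → G ⊢ t ∶ p ∥ G′ ∣ b → G ⊢ t ∶ p ∣ b) ×
    (∀ C t₁ t₂ p b → G ⊢ t₁ ≐ C ⟦ t₂ ⟧∶ p ∥ G′ ∣ b → G ⊢ t₁ ≐ C ⟦ t₂ ⟧∶ p ∣ b)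
theorem4 _≟ˡ_ _≟ˣ_ _≟ⁿ_ _⊑_ _ _ ⊑⇒⊆ _ G′⊑G =
  -- Condition (iii) supplies the inclusion from which the recursion starts.
  (λ _ _ _ → erase-match (⊑⇒⊆ G′⊑G)) , (λ _ _ _ _ _ → erase-decomp (⊑⇒⊆ G′⊑G))
  where open Erasure _≟ˡ_ _≟ˣ_ _≟ⁿ_
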